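{- Consider the following three assertions. (A) For all positive integers $I$ and $J$: if $A$ is any set of positive integers such that $|A| = H(I,J)$, then there are $I$ pairwise disjoint Golomb rulers, each being a $J$-element subset of $A$. (B) For all integers $I\ge 1$ and $J\ge 3$: $H(I+1,J)\le H(I,J)+J$. (C) For all positive integers $I_0$ and $J$: if $H(I_0,J)=I_0J$, then $H(I,J)=IJ$ for any integer $I>I_0$. Then: (1) if (A) holds, then (B) holds; (2) if (B) holds, then (C) holds; (3) if (A) holds, then (C) holds.
   Context: A Golomb ruler is a set $\{a_1,\dots,a_k\}$ of $k$ distinct non-negative integers such that all the differences $a_i-a_j$, $i\neq j$, are distinct. An $(I,J,n)$-DGR is a set of $I$ pairwise disjoint Golomb rulers, each being a $J$-element subset of $\{1,2,\dots,n\}$. For positive integers $I,J$, $H(I,J)$ is the least positive integer $n$ such that there is an $(I,J,n)$-DGR. -}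

module Defs where

open import Data.Integer.Base using (+_; _-_)
import Data.Integer.Properties as ℤ
open import Data.List.Base using (List; []; _∷_; length; map; upTo; applyUpTo; cartesianProductWith)
open import Data.List.Properties using (length-applyUpTo)
open import Data.List.Membership.Propositional using (_∈_; find; lose)
open import Data.List.Membership.Propositional.Properties
  using (∈-map⁺; ∈-upTo⁺; ∈-applyUpTo⁻; ∈-cartesianProductWith⁺)
open import Data.List.Relation.Binary.Disjoint.Propositional using (Disjoint)
open import Data.List.Relation.Binary.Disjoint.DecPropositional using (disjoint?)
open import Data.List.Relation.Unary.All as All using (All; []; _∷_)
import Data.List.Relation.Unary.All.Properties as All
open import Data.List.Relation.Unary.AllPairs as AllPairs using (AllPairs)
import Data.List.Relation.Unary.AllPairs.Properties as AllPairs
open import Data.List.Relation.Unary.Any using (any?; here)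
open import Data.List.Relation.Unary.Unique.Propositional using (Unique)
import Data.List.Relation.Unary.Unique.Propositional.Properties as Unique
open import Data.Nat.Base
  using (ℕ; zero; suc; _+_; _*_; _^_; _≤_; _<_; _>_; _≥_; z≤n; s≤s; z<s)
open import Data.Nat.Induction using (<-rec)
open import Data.Nat.Properties
open import Data.Product.Base using (∃; _×_; _,_; proj₁; proj₂)
open import Function.Base using (_∘_)
open import Level using (0ℓ)
open import Relation.Binary.Definitions using (tri<; tri≈; tri>)
open import Relation.Binary.PropositionalEquality
  using (_≡_; _≢_; refl; sym; trans; cong; cong₂; subst)
open import Relation.Nullary.Decidable using (Dec; yes; no; map′; ¬?; _×-dec_; _→-dec_)
open import Relation.Nullary.Negation using (contradiction)
open import Relation.Unary using (Pred; Decidable)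

-- Finite sets of naturals are represented by duplicate-free lists; the order
-- of the entries is irrelevant to every notion below.  Differences are taken
-- in ℤ and indexed by ordered pairs of distinct elements.

record IsGolombRuler (R : List ℕ) : Set where
  field
    unique   : Unique R
    distinct : ∀ {a b c d} → a ∈ R → b ∈ R → c ∈ R → d ∈ R →
               a ≢ b → c ≢ d → + a - + b ≡ + c - + d → a ≡ c × b ≡ d

-- For J ≥ 1 disjointness makes the entries of Rs different as sets, so that
-- Rs is indeed a set of I rulers.

record IsDisjointRulers (I J : ℕ) (A : Pred ℕ 0ℓ) (Rs : List (List ℕ)) : Set where
  field
    count    : length Rs ≡ I
    golomb   : All IsGolombRuler Rs
    size     : All (λ R → length R ≡ J) Rs
    within   : All (All A) Rs
    disjoint : AllPairs Disjoint Rs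

DisjointRulersIn : (I J : ℕ) → Pred ℕ 0ℓ → Set
DisjointRulersIn I J A = ∃ (IsDisjointRulers I J A)

DGR : (I J n : ℕ) → Set
DGR I J n = DisjointRulersIn I J (λ x → 1 ≤ x × x ≤ n)

record IsLeastPositive (P : Pred ℕ 0ℓ) (n : ℕ) : Set where
  field
    positive : 1 ≤ n
    holds    : P n
    minimal  : ∀ {m} → 1 ≤ m → P m → n ≤ m

-- H is well defined: the powers of two give an (I , J , 2 ^ (I * J))-DGR, and
-- the least n is then found by exhaustive search.

private

  2^-mono-< : ∀ {m n} → m < n → 2 ^ m < 2 ^ n
  2^-mono-< = ^-monoʳ-< 2 (s≤s (s≤s z≤n))

  2^-injective : ∀ {m n} → 2 ^ m ≡ 2 ^ n → m ≡ n
  2^-injective {m} {n} eq with <-cmp m n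
  ... | tri< m<n _ _ = contradiction eq (<⇒≢ (2^-mono-< m<n))
  ... | tri≈ _ m≡n _ = m≡n
  ... | tri> _ _ m>n = contradiction (sym eq) (<⇒≢ (2^-mono-< m>n))

  2^-dominates : ∀ {a b c} d → b < a → c < a → 2 ^ c + 2 ^ b < 2 ^ a + 2 ^ d
  2^-dominates {suc a} {b} {c} d (s≤s b≤a) (s≤s c≤a) = begin-strict
    2 ^ c + 2 ^ b      ≤⟨ +-mono-≤ (^-monoʳ-≤ 2 c≤a) (^-monoʳ-≤ 2 b≤a) ⟩
    2 ^ a + 2 ^ a      ≡⟨ cong (λ x → 2 ^ a + x) (+-identityʳ (2 ^ a)) ⟨
    2 ^ suc a          <⟨ m<m+n (2 ^ suc a) (m^n>0 2 d) ⟩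
    2 ^ suc a + 2 ^ d  ∎
    where open ≤-Reasoning

  2^-sums : ∀ a b c d → a ≢ b → 2 ^ a + 2 ^ d ≡ 2 ^ c + 2 ^ b → a ≡ c
  2^-sums a b c d a≢b eq with <-cmp a c
  ... | tri≈ _ a≡c _ = a≡c
  ... | tri< a<c _ _ with <-cmp d c
  ...   | tri< d<c _ _ = contradiction eq (<⇒≢ (2^-dominates b d<c a<c))
  ...   | tri≈ _ refl _ = contradiction
            (2^-injective (+-cancelʳ-≡ (2 ^ d) _ _ (trans eq (+-comm (2 ^ d) (2 ^ b))))) a≢b
  ...   | tri> _ _ c<d with <-cmp d b
  ...     | tri< d<b _ _ = contradiction (trans eq (+-comm (2 ^ c) (2 ^ b)))
              (<⇒≢ (2^-dominates c d<b (<-trans a<c (<-trans c<d d<b))))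
  ...     | tri≈ _ refl _ = 2^-injective (+-cancelʳ-≡ (2 ^ d) _ _ eq)
  ...     | tri> _ _ b<d = contradiction (trans (sym eq) (+-comm (2 ^ a) (2 ^ d)))
              (<⇒≢ (2^-dominates a b<d c<d))
  2^-sums a b c d a≢b eq | tri> _ _ c<a with <-cmp b a
  ...   | tri< b<a _ _ = contradiction (sym eq) (<⇒≢ (2^-dominates d b<a c<a))
  ...   | tri≈ _ b≡a _ = contradiction (sym b≡a) a≢b
  ...   | tri> _ _ a<b with <-cmp d b
  ...     | tri< d<b _ _ = contradiction (trans eq (+-comm (2 ^ c) (2 ^ b)))
              (<⇒≢ (2^-dominates c d<b a<b))
  ...     | tri≈ _ refl _ = 2^-injective (+-cancelʳ-≡ (2 ^ d) _ _ eq)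
  ...     | tri> _ _ b<d = contradiction (trans (sym eq) (+-comm (2 ^ a) (2 ^ d)))
              (<⇒≢ (2^-dominates a b<d (<-trans c<a (<-trans a<b b<d))))

  differences⇒sums : ∀ a b c d → + a - + b ≡ + c - + d → a + d ≡ c + b
  differences⇒sums a b c d eq = ℤ.+-injective (begin
    + a ℤ+ + d                       ≡⟨ cong (_ℤ+ + d) (lemma (+ a) (+ b)) ⟨
    (+ a - + b) ℤ+ + b ℤ+ + d        ≡⟨ cong (λ z → z ℤ+ + b ℤ+ + d) eq ⟩
    (+ c - + d) ℤ+ + b ℤ+ + d        ≡⟨ ℤ.+-assoc (+ c - + d) (+ b) (+ d) ⟩
    (+ c - + d) ℤ+ (+ b ℤ+ + d)      ≡⟨ cong ((+ c - + d) ℤ+_) (ℤ.+-comm (+ b) (+ d)) ⟩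
    (+ c - + d) ℤ+ (+ d ℤ+ + b)      ≡⟨ ℤ.+-assoc (+ c - + d) (+ d) (+ b) ⟨
    (+ c - + d) ℤ+ + d ℤ+ + b        ≡⟨ cong (_ℤ+ + b) (lemma (+ c) (+ d)) ⟩
    + c ℤ+ + b                       ∎)
    where
    open Relation.Binary.PropositionalEquality.≡-Reasoning
    open import Data.Integer.Base using (ℤ; -_) renaming (_+_ to _ℤ+_)
    lemma : ∀ (x y : ℤ) → (x - y) ℤ+ y ≡ x
    lemma x y = trans (ℤ.+-assoc x (- y) y)
      (trans (cong (x ℤ+_) (ℤ.+-inverseˡ y)) (ℤ.+-identityʳ x))

  powers : (s J : ℕ) → List ℕ
  powers s J = applyUpTo (λ k → 2 ^ (s + k)) J

  powers-golomb : ∀ s J → IsGolombRuler (powers s J)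
  powers-golomb s J = record
    { unique   = Unique.applyUpTo⁺₁ _ J
                   (λ i<j _ eq → <⇒≢ i<j (+-cancelˡ-≡ s _ _ (2^-injective eq)))
    ; distinct = distinct
    }
    where
    distinct : ∀ {a b c d} → a ∈ powers s J → b ∈ powers s J → c ∈ powers s J →
               d ∈ powers s J → a ≢ b → c ≢ d → + a - + b ≡ + c - + d → a ≡ c × b ≡ d
    distinct a∈ b∈ c∈ d∈ a≢b _ eq
      with i , _ , refl ← ∈-applyUpTo⁻ _ a∈
         | j , _ , refl ← ∈-applyUpTo⁻ _ b∈
         | k , _ , refl ← ∈-applyUpTo⁻ _ c∈
         | l , _ , refl ← ∈-applyUpTo⁻ _ d∈
      = a≡c , sym (+-cancelˡ-≡ (2 ^ (s + i)) _ _
                     (trans sums (cong (λ x → x + 2 ^ (s + j)) (sym a≡c))))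
      where
      sums = differences⇒sums (2 ^ (s + i)) (2 ^ (s + j)) (2 ^ (s + k)) (2 ^ (s + l)) eq
      a≡c : 2 ^ (s + i) ≡ 2 ^ (s + k)
      a≡c = cong (2 ^_) (2^-sums (s + i) (s + j) (s + k) (s + l) (a≢b ∘ cong (2 ^_)) sums)

  block< : ∀ {i j k J} → i < j → k < J → i * J + k < j * J
  block< {i} {j} {k} {J} i<j k<J = begin-strict
    i * J + k  <⟨ +-monoʳ-< (i * J) k<J ⟩
    i * J + J  ≡⟨ +-comm (i * J) J ⟩
    suc i * J  ≤⟨ *-monoˡ-≤ J i<j ⟩
    j * J      ∎
    where open ≤-Reasoning

  dgr-exists : ∀ I J → DGR I J (2 ^ (I * J))
  dgr-exists I J = applyUpTo (λ i → powers (i * J) J) I , record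
    { count    = length-applyUpTo _ I
    ; golomb   = All.applyUpTo⁺₂ _ I (λ i → powers-golomb (i * J) J)
    ; size     = All.applyUpTo⁺₂ _ I (λ i → length-applyUpTo _ J)
    ; within   = All.applyUpTo⁺₁ _ I (λ {i} i<I → All.applyUpTo⁺₁ _ J (λ {k} k<J →
                   m^n>0 2 (i * J + k) , <⇒≤ (2^-mono-< (block< i<I k<J))))
    ; disjoint = AllPairs.applyUpTo⁺₁ _ I disjoint
    }
    where
    disjoint : ∀ {i j} → i < j → j < I → Disjoint (powers (i * J) J) (powers (j * J) J)
    disjoint {i} {j} i<j _ (x∈ , x∈′)
      with k , k<J , refl ← ∈-applyUpTo⁻ _ x∈
         | l , _ , eq ← ∈-applyUpTo⁻ _ x∈′
      = <⇒≢ (2^-mono-< (<-≤-trans (block< {i} {j} i<j k<J) (m≤m+n (j * J) l))) eq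

  isGolombRuler? : Decidable IsGolombRuler
  isGolombRuler? R = map′
    (λ (u , ds) → record
      { unique   = u
      ; distinct = λ a∈ b∈ c∈ d∈ →
          All.lookup (All.lookup (All.lookup (All.lookup ds a∈) b∈) c∈) d∈
      })
    (λ g → let open IsGolombRuler g in unique ,
      All.tabulate λ a∈ → All.tabulate λ b∈ → All.tabulate λ c∈ → All.tabulate λ d∈ →
        distinct a∈ b∈ c∈ d∈)
    (AllPairs.allPairs? (λ x y → ¬? (x ≟ y)) R ×-dec
     All.all? (λ a → All.all? (λ b → All.all? (λ c → All.all? (λ d →
       ¬? (a ≟ b) →-dec ¬? (c ≟ d) →-dec (+ a - + b) ℤ.≟ (+ c - + d) →-dec
       (a ≟ c ×-dec b ≟ d)) R) R) R) R)

  isDisjointRulers? : ∀ I J {A} → Decidable A → Decidable (IsDisjointRulers I J A)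
  isDisjointRulers? I J A? Rs = map′
    (λ (c , g , s , w , d) → record
      { count = c ; golomb = g ; size = s ; within = w ; disjoint = d })
    (λ r → let open IsDisjointRulers r in count , golomb , size , within , disjoint)
    (length Rs ≟ I ×-dec
     All.all? isGolombRuler? Rs ×-dec
     All.all? (λ R → length R ≟ J) Rs ×-dec
     All.all? (All.all? A?) Rs ×-dec
     AllPairs.allPairs? (disjoint? _≟_) Rs)

  listsOf : {X : Set} → List X → ℕ → List (List X)
  listsOf xs zero    = [] ∷ []
  listsOf xs (suc k) = cartesianProductWith _∷_ xs (listsOf xs k)

  ∈-listsOf : {X : Set} {xs : List X} (ys : List X) →
              All (_∈ xs) ys → ys ∈ listsOf xs (length ys)
  ∈-listsOf []       []         = here refl
  ∈-listsOf (y ∷ ys) (y∈ ∷ ys∈) = ∈-cartesianProductWith⁺ _∷_ y∈ (∈-listsOf ys ys∈)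

  dgr? : ∀ I J → Decidable (DGR I J)
  dgr? I J n = map′
    (λ p → let Rs , _ , r = find p in Rs , r)
    (λ (Rs , r) → lose (candidate Rs r) r)
    (any? (isDisjointRulers? I J (λ x → 1 ≤? x ×-dec x ≤? n))
          (listsOf (listsOf (map suc (upTo n)) J) I))
    where
    interval : ∀ {x} → 1 ≤ x × x ≤ n → x ∈ map suc (upTo n)
    interval {suc x} (_ , x<n) = ∈-map⁺ suc (∈-upTo⁺ x<n)

    candidate : ∀ Rs → IsDisjointRulers I J (λ x → 1 ≤ x × x ≤ n) Rs →
                Rs ∈ listsOf (listsOf (map suc (upTo n)) J) I
    candidate Rs r = subst (λ k → Rs ∈ listsOf _ k) count
      (∈-listsOf Rs (All.zipWith
        (λ {R} (sz , w) → subst (λ k → R ∈ listsOf _ k) sz (∈-listsOf R (All.map interval w)))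
        (size , within)))
      where open IsDisjointRulers r

  leastPositive : ∀ {P : Pred ℕ 0ℓ} → Decidable P → ∀ n → 1 ≤ n → P n → ∃ (IsLeastPositive P)
  leastPositive {P} P? = <-rec _ λ n rec 1≤n Pn →
    case-of n rec 1≤n Pn (anyUpTo? (λ m → 1 ≤? m ×-dec P? m) n)
    where
    case-of : ∀ n → (∀ {m} → m < n → 1 ≤ m → P m → ∃ (IsLeastPositive P)) →
              1 ≤ n → P n → Dec (∃ λ m → m < n × 1 ≤ m × P m) → ∃ (IsLeastPositive P)
    case-of n rec 1≤n Pn (yes (m , m<n , 1≤m , Pm)) = rec m<n 1≤m Pm
    case-of n rec 1≤n Pn (no ¬smaller) = n , record
      { positive = 1≤n
      ; holds    = Pn
      ; minimal  = λ 1≤m Pm → ≮⇒≥ (λ m<n → ¬smaller (_ , m<n , 1≤m , Pm))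
      }

opaque

  leastDGR : ∀ I J → ∃ (IsLeastPositive (DGR I J))
  leastDGR I J = leastPositive (dgr? I J) (2 ^ (I * J)) (m^n>0 2 (I * J)) (dgr-exists I J)

H : ℕ → ℕ → ℕ
H I J = proj₁ (leastDGR I J)

H-isLeast : ∀ I J → IsLeastPositive (DGR I J) (H I J)
H-isLeast I J = proj₂ (leastDGR I J)

AssertionA : Set
AssertionA = ∀ I J → 1 ≤ I → 1 ≤ J →
  ∀ (A : List ℕ) → Unique A → All (1 ≤_) A → length A ≡ H I J →
  DisjointRulersIn I J (_∈ A)

AssertionB : Set
AssertionB = ∀ I J → 1 ≤ I → 3 ≤ J → H (I + 1) J ≤ H I J + J

AssertionC : Set
AssertionC = ∀ I₀ J → 1 ≤ I₀ → 1 ≤ J → H I₀ J ≡ I₀ * J →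
  ∀ I → I₀ < I → H I J ≡ I * J

{-# OPTIONS --safe #-}

-- (A) ⇒ (B): an (I , J , H(I,J))-DGR contains a J-element ruler R.  Removing R
-- from {1,…,H(I,J)+J} leaves H(I,J) integers, in which (A) finds I rulers.
-- (B) ⇒ (C): always I J ≤ H(I,J), since I disjoint rulers occupy I J integers,
-- and (B) propagates the matching upper bound.  For J ≤ 2, outside the range of
-- (B), any J distinct integers form a ruler, so a DGR extends by the J integers
-- following it.

module Submission where

open import Defs
open import Algebra.Properties.AbelianGroup using (⁻¹-anti-homo‿-)
open import Data.Integer.Base using (ℤ; +_; -_; _-_; 0ℤ)
import Data.Integer.Properties as ℤ
open import Data.List.Base using (List; []; _∷_; _++_; length; concat; filter; applyUpTo)
open import Data.List.Membership.Propositional using (_∈_; _∉_)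
open import Data.List.Membership.Propositional.Properties
open import Data.List.Properties using (length-++; length-applyUpTo)
open import Data.List.Relation.Binary.Permutation.Propositional.Properties
  using (shift; ↭-length; ∈-resp-↭)
open import Data.List.Relation.Binary.Subset.Propositional using (_⊆_)
open import Data.List.Relation.Unary.All as All using (All; []; _∷_)
import Data.List.Relation.Unary.All.Properties as All
open import Data.List.Relation.Unary.AllPairs using ([]; _∷_)
open import Data.List.Relation.Unary.Any using (here; there)
open import Data.List.Relation.Unary.Unique.Propositional using (Unique)
import Data.List.Relation.Unary.Unique.Propositional.Properties as Unique
open import Data.Nat.Base
open import Data.Nat.Properties
open import Data.List.Membership.DecPropositional _≟_ using (_∈?_)
open import Data.Product.Base using (∃; _×_; _,_; proj₁; proj₂)
open import Data.Sum.Base using ([_,_]′)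
open import Function.Base using (_∘_)
open import Level using (Level; 0ℓ)
open import Relation.Binary.PropositionalEquality
  using (_≡_; _≢_; refl; sym; trans; cong; subst; module ≡-Reasoning)
open import Relation.Nullary.Decidable using (yes; no; ¬?)
open import Relation.Nullary.Negation using (contradiction)
open import Relation.Unary using (Pred)

private
  variable
    a : Level
    X : Set a
    I J n : ℕ

-- Pigeonhole by induction on `xs`: one occurrence of the head is cut out of `ys`, and since the
-- head does not recur in the tail, the tail still embeds in `as ++ bs`.
length-⊆ : {xs ys : List X} → Unique xs → xs ⊆ ys → length xs ≤ length ys
length-⊆ [] _ = z≤n
length-⊆ {xs = x ∷ xs} (x≢xs ∷ uxs) sub
  with as , bs , refl ← ∈-∃++ (sub (here refl))
  = subst (suc (length xs) ≤_) (sym (↭-length (shift x as bs))) (s≤s (length-⊆ uxs sub′))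
  where
  sub′ : xs ⊆ as ++ bs
  sub′ v∈xs with ∈-resp-↭ (shift x as bs) (sub (there v∈xs))
  ... | here refl = contradiction refl (All.lookup x≢xs v∈xs)
  ... | there v∈  = v∈

length-concat : (xss : List (List X)) → All (λ xs → length xs ≡ J) xss →
                length (concat xss) ≡ length xss * J
length-concat []         []           = refl
length-concat (xs ∷ xss) (refl ∷ eqs) =
  trans (length-++ xs) (cong (λ k → length xs + k) (length-concat xss eqs))

infix 5 _∖_

_∖_ : List ℕ → List ℕ → List ℕ
S ∖ R = filter (λ x → ¬? (x ∈? R)) S

∈-∖⁻ : ∀ S {R x} → x ∈ S ∖ R → x ∈ S × x ∉ R
∈-∖⁻ S {R} = ∈-filter⁻ (λ x → ¬? (x ∈? R)) {xs = S}

-- `R ++ (S ∖ R)` and `S` are duplicate-free and have the same entries, so `length-⊆` applies in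
-- both directions.
length-∖ : ∀ {S R} → Unique S → Unique R → R ⊆ S → length R + length (S ∖ R) ≡ length S
length-∖ {S} {R} uS uR R⊆S = trans (sym (length-++ R)) (≤-antisym
  (length-⊆ (Unique.++⁺ uR (Unique.filter⁺ _ uS) (λ (v∈R , v∈) → proj₂ (∈-∖⁻ S v∈) v∈R))
            ([ R⊆S , proj₁ ∘ ∈-∖⁻ S ]′ ∘ ∈-++⁻ R))
  (length-⊆ uS cover))
  where
  cover : S ⊆ R ++ (S ∖ R)
  cover {x} x∈S with x ∈? R
  ... | yes x∈R = ∈-++⁺ˡ x∈R
  ... | no  x∉R = ∈-++⁺ʳ R (∈-filter⁺ _ x∈S x∉R)

-- Serves in two ways: `block 0 n` lists {1,...,n}, and `block (H I J) J` lists the `J` integers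
-- just after {1,...,H(I,J)}.
block : ℕ → ℕ → List ℕ
block n J = applyUpTo (λ k → suc (n + k)) J

block-unique : ∀ n J → Unique (block n J)
block-unique n J =
  Unique.applyUpTo⁺₁ _ J (λ i<j _ eq → <⇒≢ i<j (+-cancelˡ-≡ n _ _ (suc-injective eq)))

block-bounds : ∀ n J → All (λ x → n < x × x ≤ n + J) (block n J)
block-bounds n J =
  All.applyUpTo⁺₁ _ J (λ {k} k<J → s≤s (m≤m+n n k) , +-monoʳ-< n k<J)

∈-block₀⁺ : ∀ {x} → 1 ≤ x × x ≤ n → x ∈ block 0 n
∈-block₀⁺ {x = suc x} (_ , x<n) = ∈-applyUpTo⁺ suc x<n

-- Each ruler is duplicate-free and no two share an entry, so their concatenation is a
-- duplicate-free list inside `block 0 n`, and pigeonhole applies.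
I*J≤n : DGR I J n → I * J ≤ n
I*J≤n {I} {J} {n} (Rs , rulers) = begin
  I * J                ≡⟨ cong (_* J) count ⟨
  length Rs * J        ≡⟨ length-concat Rs size ⟨
  length (concat Rs)   ≤⟨ length-⊆ (Unique.concat⁺ (All.map IsGolombRuler.unique golomb) disjoint)
                            (∈-block₀⁺ ∘ All.lookup (All.concat⁺ within)) ⟩
  length (block 0 n)   ≡⟨ length-applyUpTo suc n ⟩
  n                    ∎
  where
  open IsDisjointRulers rulers
  open ≤-Reasoning

-- Common to both ways of gaining a ruler: `B` is the range {1,...,H(I,J)} when `J ≤ 2`, and
-- membership in `S ∖ R` when (A) is applied.
addRuler : ∀ {A B : Pred ℕ 0ℓ} {R} → IsGolombRuler R → length R ≡ J → All A R →
           (∀ {x} → B x → A x × x ∉ R) →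
           DisjointRulersIn I J B → DisjointRulersIn (I + 1) J A
addRuler {I = I} {R = R} R-golomb R-size R⊆A B⊆A∖R (Rs , rulers) = R ∷ Rs , record
  { count    = trans (cong suc count) (+-comm 1 I)
  ; golomb   = R-golomb ∷ golomb
  ; size     = R-size ∷ size
  ; within   = R⊆A ∷ All.map (All.map (proj₁ ∘ B⊆A∖R)) within
  ; disjoint = All.map (λ R′⊆B {_} (v∈R , v∈R′) → proj₂ (B⊆A∖R (All.lookup R′⊆B v∈R′)) v∈R) within
               ∷ disjoint
  }
  where open IsDisjointRulers rulers

someRuler : ∀ {A} → 1 ≤ I → DisjointRulersIn I J A →
            ∃ λ R → IsGolombRuler R × length R ≡ J × All A R
someRuler 1≤I (Rs , record { count = refl ; golomb = g ; size = s ; within = w }) = first 1≤I g s w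
  where
  first : ∀ {A Rs} → 1 ≤ length Rs → All IsGolombRuler Rs → All (λ R → length R ≡ J) Rs →
          All (All A) Rs → ∃ λ R → IsGolombRuler R × length R ≡ J × All A R
  first _ (g ∷ _) (s ∷ _) (w ∷ _) = _ , g , s , w

-- `j - i` is the negative of `i - j`, so the hypothesis makes `i - j` its own negative, hence zero.
i-j≡j-i⇒i≡j : ∀ i j → i - j ≡ j - i → i ≡ j
i-j≡j-i⇒i≡j i j eq = ℤ.i-j≡0⇒i≡j i j
  (i≡-i⇒i≡0 (i - j) (trans eq (sym (⁻¹-anti-homo‿- ℤ.+-0-abelianGroup i j))))
  where
  i≡-i⇒i≡0 : ∀ i → i ≡ - i → i ≡ 0ℤ
  -- For nonzero `i` the two sides have different constructors, so the equation is absurd.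
  i≡-i⇒i≡0 (+ zero) _ = refl

-- Two elements give only two ordered pairs of distinct entries. Two such pairs are equal, as
-- claimed, or reversed; reversed pairs have opposite differences, which agree only if the entries
-- coincide.
short⇒golomb : ∀ {R} → Unique R → length R ≤ 2 → IsGolombRuler R
short⇒golomb {R} uR R≤2 = record { unique = uR ; distinct = distinct R R≤2 }
  where
  distinct : ∀ R → length R ≤ 2 → ∀ {a b c d} → a ∈ R → b ∈ R → c ∈ R → d ∈ R →
             a ≢ b → c ≢ d → + a - + b ≡ + c - + d → a ≡ c × b ≡ d
  distinct (x ∷ []) _ (here refl) (here refl) _ _ a≢b = contradiction refl a≢b
  distinct (x ∷ y ∷ []) _ (here refl) (here refl) _ _ a≢b = contradiction refl a≢b
  distinct (x ∷ y ∷ []) _ (there (here refl)) (there (here refl)) _ _ a≢b = contradiction refl a≢b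
  distinct (x ∷ y ∷ []) _ _ _ (here refl) (here refl) _ c≢d = contradiction refl c≢d
  distinct (x ∷ y ∷ []) _ _ _ (there (here refl)) (there (here refl)) _ c≢d = contradiction refl c≢d
  distinct (x ∷ y ∷ []) _ (here refl) (there (here refl)) (here refl) (there (here refl)) _ _ _ =
    refl , refl
  distinct (x ∷ y ∷ []) _ (there (here refl)) (here refl) (there (here refl)) (here refl) _ _ _ =
    refl , refl
  distinct (x ∷ y ∷ []) _ (here refl) (there (here refl)) (there (here refl)) (here refl) x≢y _ eq =
    contradiction (ℤ.+-injective (i-j≡j-i⇒i≡j (+ x) (+ y) eq)) x≢y
  distinct (x ∷ y ∷ []) _ (there (here refl)) (here refl) (here refl) (there (here refl)) y≢x _ eq =
    contradiction (ℤ.+-injective (i-j≡j-i⇒i≡j (+ y) (+ x) eq)) y≢x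
  distinct (_ ∷ _ ∷ _ ∷ _) (s≤s (s≤s ()))

H≤ : 1 ≤ n → DGR I J n → H I J ≤ n
H≤ {I = I} {J} = IsLeastPositive.minimal (H-isLeast I J)

1≤H+J : ∀ I J → 1 ≤ H I J + J
1≤H+J I J = ≤-trans (IsLeastPositive.positive (H-isLeast I J)) (m≤m+n (H I J) J)

B-short : ∀ I J → J ≤ 2 → H (I + 1) J ≤ H I J + J
B-short I J J≤2 = H≤ (1≤H+J I J) (addRuler
  (short⇒golomb (block-unique h J) (subst (_≤ 2) (sym (length-applyUpTo _ J)) J≤2))
  (length-applyUpTo _ J)
  (All.map (λ (h<x , x≤) → ≤-trans z<s h<x , x≤) (block-bounds h J))
  -- Entries of the new block exceed `h`, so no point of {1,...,h} lies in it.
  (λ (1≤x , x≤h) → (1≤x , ≤-trans x≤h (m≤m+n h J)) ,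
                   (λ x∈ → <⇒≱ (proj₁ (All.lookup (block-bounds h J) x∈)) x≤h))
  (IsLeastPositive.holds (H-isLeast I J)))
  where
  h : ℕ
  h = H I J

A⇒B : AssertionA → AssertionB
A⇒B assertA I J 1≤I 3≤J
  with R , R-golomb , R-size , R≤h ← someRuler 1≤I (IsLeastPositive.holds (H-isLeast I J))
  = H≤ (1≤H+J I J) (addRuler R-golomb R-size R≤h+J
      (λ x∈ → let x∈S , x∉R = ∈-∖⁻ S x∈ in All.lookup (block-bounds 0 (h + J)) x∈S , x∉R)
      (assertA I J 1≤I (≤-trans z<s 3≤J) (S ∖ R)
        (Unique.filter⁺ _ (block-unique 0 (h + J)))
        (All.filter⁺ _ (All.map proj₁ (block-bounds 0 (h + J))))
        size))
  where
  h : ℕ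
  h = H I J

  S : List ℕ
  S = block 0 (h + J)

  R≤h+J : All (λ x → 1 ≤ x × x ≤ h + J) R
  R≤h+J = All.map (λ (1≤x , x≤h) → 1≤x , ≤-trans x≤h (m≤m+n h J)) R≤h

  open ≡-Reasoning

  -- `R` takes exactly `J` of the `h + J` entries of `S`; `length-∖` counts this additively, so `J`
  -- is cancelled rather than subtracted.
  size : length (S ∖ R) ≡ h
  size = +-cancelˡ-≡ J _ _ (begin
    J + length (S ∖ R)         ≡⟨ cong (_+ length (S ∖ R)) R-size ⟨
    length R + length (S ∖ R)  ≡⟨ length-∖ (block-unique 0 (h + J)) (IsGolombRuler.unique R-golomb)
                                    (∈-block₀⁺ ∘ All.lookup R≤h+J) ⟩
    length S                   ≡⟨ length-applyUpTo suc (h + J) ⟩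
    h + J                      ≡⟨ +-comm h J ⟩
    J + h                      ∎)

B⇒C : AssertionB → AssertionC
B⇒C assertB I₀ J 1≤I₀ _ eq I I₀<I =
  subst (λ I → H I J ≡ I * J) (m∸n+n≡m (<⇒≤ I₀<I)) (climb (I ∸ I₀))
  where
  step : ∀ I → 1 ≤ I → H (I + 1) J ≤ H I J + J
  step I 1≤I with 3 ≤? J
  ... | yes 3≤J = assertB I J 1≤I 3≤J
  -- (B) is silent here; the failure of `3 ≤ J` leaves `J ≤ 2`.
  ... | no  3≰J = B-short I J (s≤s⁻¹ (≰⇒> 3≰J))

  open ≤-Reasoning

  -- Indexing by `k + I₀` lets `suc k + I₀` reduce to `suc (k + I₀)`; taking `k` to be `I ∸ I₀`
  -- recovers `I` because `I₀ ≤ I`.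
  climb : ∀ k → H (k + I₀) J ≡ (k + I₀) * J
  climb zero    = eq
  climb (suc k) = ≤-antisym
    (begin
      H (suc (k + I₀)) J  ≡⟨ cong (λ I → H I J) (+-comm 1 (k + I₀)) ⟩
      H (k + I₀ + 1) J    ≤⟨ step (k + I₀) (≤-trans 1≤I₀ (m≤n+m I₀ k)) ⟩
      H (k + I₀) J + J    ≡⟨ cong (_+ J) (climb k) ⟩
      (k + I₀) * J + J    ≡⟨ +-comm ((k + I₀) * J) J ⟩
      suc (k + I₀) * J    ∎)
    (I*J≤n (IsLeastPositive.holds (H-isLeast (suc (k + I₀)) J)))

theorem2 : (AssertionA → AssertionB) × (AssertionB → AssertionC) × (AssertionA → AssertionC)
theorem2 = A⇒B , B⇒C , B⇒C ∘ A⇒B
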